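{- For every relation $r\subseteq\Sigma\times\Sigma$ and every variable $x\in V$, $$\mathsf E_x(\mathbf{rely}\,r)=\mathbf{rely}(\mathsf A_xr),$$ where $\mathsf A_xr=\overline{\mathsf E_x\overline r}$.
   Context: Commands. $(\mathcal C,\le,\bigwedge,\bigsqcup,\bot,\top)$ is a complete distributive lattice (with arbitrary meet $\bigwedge$, binary meet $\sqcap$, arbitrary join $\bigsqcup$ and binary join $\sqcup$) whose elements are called commands. It has an associative sequential composition $;$ with identity $\mathbf{nil}$, monotone in both arguments, and an associative, commutative, idempotent, monotone weak conjunction $\Cap$. Iterations: $c^0=\mathbf{nil}$, $c^{i+1}=c;c^i$; $c^\star$ (resp. $c^\omega$) is the least (resp. greatest) fixed point of $y\mapsto\mathbf{nil}\sqcup c;y$; $c^\infty=c^\omega;\bot$. One has $c^\star=\bigsqcup_{i\in\mathbb N}c^i$ and $c^\omega=c^\star\sqcup c^\infty$. States and relations. $V$ is a countable set of variables, $S$ a set, $\Sigma$ the set of partial functions $V\rightharpoonup S$. $\mathrm{id}(\overline x)$ relates $\sigma,\sigma'\in\Sigma$ iff they agree on every variable other than $x$. For $p\subseteq\Sigma$, $\mathsf E_x p$ is the image of $p$ under $\mathrm{id}(\overline x)$. For $r\subseteq\Sigma\times\Sigma$ (with $\circ$ denoting left-to-right relational composition), $\mathsf E^{\mathsf{first}}_x r=\mathrm{id}(\overline x)\circ r$, $\mathsf E^{\mathsf{last}}_x r=r\circ\mathrm{id}(\overline x)$, $\mathsf E_x r=\mathrm{id}(\overline x)\circ r\circ\mathrm{id}(\overline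 x)$. $\overline r$ is the complement of $r$ in $\Sigma\times\Sigma$. Primitive commands. $\tau:\mathcal P(\Sigma)\to\mathcal C$ (tests) and $\pi,\epsilon:\mathcal P(\Sigma\times\Sigma)\to\mathcal A$ (program and environment steps) are injective homomorphisms of complete Boolean algebras onto complete Boolean sub-algebras of $\mathcal C$ (joins, and nonempty meets, computed in $\mathcal C$; complement relative to the greatest element of the sub-algebra), with $\tau(\emptyset)=\pi(\emptyset)=\epsilon(\emptyset)=\bot$ and $\tau(\Sigma)=\mathbf{nil}$. $\mathcal A\subseteq\mathcal C$ is the complete Boolean sub-algebra of atomic steps, in which $\boldsymbol\pi=\pi(\Sigma\times\Sigma)$ and $\boldsymbol\epsilon=\epsilon(\Sigma\times\Sigma)$ are complementary; $\boldsymbol\alpha=\boldsymbol\pi\sqcup\boldsymbol\epsilon$. $\mathbf{chaos}=\boldsymbol\alpha^\omega$ is the identity of $\Cap$, and $a=a\Cap(\boldsymbol\alpha;\mathbf{chaos})$ for all $a\in\mathcal A$. Localisation. For each $x\in V$ there are unary operators $\mathsf E_x,\mathsf E^{\mathsf{first}}_x,\mathsf E^{\mathsf{last}}_x$ on $\mathcal C$ (binding tighter than binary operators). Each family $F\in\{\mathsf E,\mathsf E^{\mathsf{first}},\mathsf E^{\mathsf{last}}\}$ satisfies $c\le F_xc$; $F_x(c\sqcap F_xd)=F_xc\sqcap F_xd$; $F_xF_yc=F_yF_xc$; $F_x(\bigsqcup C)=\bigsqcup_{c\in C}F_xc$. Further axioms: $\mathsf E^{\mathsf{first}}_xc\le\mathsf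 E_xc$; $\mathsf E^{\mathsf{last}}_xc\le\mathsf E_xc$; $\mathsf E_x\mathsf E^{\mathsf{first}}_yc=\mathsf E^{\mathsf{first}}_y\mathsf E_xc$; $\mathsf E_x\mathsf E^{\mathsf{last}}_yc=\mathsf E^{\mathsf{last}}_y\mathsf E_xc$; $\mathsf E^{\mathsf{first}}_x\mathsf E^{\mathsf{last}}_yc=\mathsf E^{\mathsf{last}}_y\mathsf E^{\mathsf{first}}_xc$; $\mathsf E_x\tau(p)=\mathsf E^{\mathsf{first}}_x\tau(p)=\mathsf E^{\mathsf{last}}_x\tau(p)=\tau(\mathsf E_xp)$; $F_x\pi(r)=\pi(F_xr)$ and $F_x\epsilon(r)=\epsilon(F_xr)$ for each of the three $F$; $\mathsf E_x(c;\mathsf E^{\mathsf{first}}_xd)=\mathsf E_xc;\mathsf E_xd=\mathsf E_x(\mathsf E^{\mathsf{last}}_xc;d)$; if $c=c\Cap(\boldsymbol\alpha;\mathbf{chaos})$ then $\mathsf E^{\mathsf{first}}_x(c;d)=\mathsf E^{\mathsf{first}}_xc;d$ and $\mathsf E^{\mathsf{last}}_x(d;c)=d;\mathsf E^{\mathsf{last}}_xc$; $\mathsf E_x(c\Cap\mathsf E_xd)=\mathsf E_xc\Cap\mathsf E_xd$; $\mathsf E^{\mathsf{first}}_x(c\Cap\mathsf E^{\mathsf{first}}_xd)=\mathsf E^{\mathsf{first}}_xc\Cap\mathsf E^{\mathsf{first}}_xd$. Rely command. $\mathbf{rely}\,r=(\boldsymbol\alpha\sqcup\epsilon(\overline r);\top)^\omega$,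 and in this algebra $\mathbf{rely}\,r=\boldsymbol\alpha^\omega;(\mathbf{nil}\sqcup\epsilon(\overline r);\top)$. -}

module Defs where

open import Algebra.Core using (Op₁; Op₂)
open import Algebra.Structures using (IsMonoid; IsIdempotentCommutativeMonoid)
open import Data.Maybe.Base using (Maybe)
open import Data.Nat.Base using (ℕ)
open import Data.Nat.GeneralisedArithmetic using (fold)
open import Data.Product.Base using (_×_; _,_; ∃-syntax; uncurry; curry)
open import Level using (Level; Lift; lower) renaming (suc to lsuc)
open import Relation.Binary.Construct.Composition using (_;_)
open import Relation.Binary.Core using (Rel; _Preserves_⟶_; _Preserves₂_⟶_⟶_)
open import Relation.Binary.Definitions using (Maximum; Minimum; _Respects_)
open import Relation.Binary.Lattice.Structures using (IsDistributiveLattice)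
open import Relation.Binary.PropositionalEquality.Core using (_≡_; _≢_)
open import Relation.Unary using (Pred; _∈_; ∁; ⋃; ⋂; _≐_)
open import Relation.Unary.Polymorphic using (∅; U)

private
  variable
    ℓ : Level

-- Arbitrary joins and meets are taken over families indexed by `I : Set ℓ`.
-- As Carrier and _≤_ live in `Set ℓ` as well, a subset `P : Pred Carrier ℓ`
-- is covered by the family `proj₁ : ∃ P → Carrier`.

record CompleteDistributiveLattice ℓ : Set (lsuc ℓ) where
  infix  4 _≈_ _≤_
  infixr 6 _⊔_
  infixr 7 _⊓_
  field
    Carrier               : Set ℓ
    _≈_                   : Rel Carrier ℓ
    _≤_                   : Rel Carrier ℓ
    _⊔_                   : Op₂ Carrier
    _⊓_                   : Op₂ Carrier
    isDistributiveLattice : IsDistributiveLattice _≈_ _≤_ _⊔_ _⊓_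
    ⊤                     : Carrier
    ⊥                     : Carrier
    maximum               : Maximum _≤_ ⊤
    minimum               : Minimum _≤_ ⊥
    ⨆                     : {I : Set ℓ} → (I → Carrier) → Carrier
    ⨆-upper               : {I : Set ℓ} (f : I → Carrier) → ∀ i → f i ≤ ⨆ f
    ⨆-least               : {I : Set ℓ} (f : I → Carrier) →
                            ∀ c → (∀ i → f i ≤ c) → ⨆ f ≤ c
    ⨅                     : {I : Set ℓ} → (I → Carrier) → Carrier
    ⨅-lower               : {I : Set ℓ} (f : I → Carrier) → ∀ i → ⨅ f ≤ f i
    ⨅-greatest            : {I : Set ℓ} (f : I → Carrier) →
                            ∀ c → (∀ i → c ≤ f i) → c ≤ ⨅ f

module _ (L : CompleteDistributiveLattice ℓ) where
  open CompleteDistributiveLattice L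

  IsLeastFixedPoint : (Carrier → Carrier) → Carrier → Set ℓ
  IsLeastFixedPoint f c = f c ≈ c × (∀ d → f d ≈ d → c ≤ d)

  IsGreatestFixedPoint : (Carrier → Carrier) → Carrier → Set ℓ
  IsGreatestFixedPoint f c = f c ≈ c × (∀ d → f d ≈ d → d ≤ c)

  -- The inhabitant of I in ⨅-closed restricts to nonempty meets.  The empty
  -- join gives ⊥ ∈ B, so complements are taken in the interval [⊥, top].

  record IsCompleteBooleanSubalgebra (B : Pred Carrier ℓ) (top : Carrier)
                                     : Set (lsuc ℓ) where
    field
      respects   : B Respects _≈_
      ⨆-closed   : {I : Set ℓ} (f : I → Carrier) →
                   (∀ i → f i ∈ B) → ⨆ f ∈ B
      ⨅-closed   : {I : Set ℓ} → I → (f : I → Carrier) →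
                   (∀ i → f i ∈ B) → ⨅ f ∈ B
      top∈       : top ∈ B
      greatest   : ∀ a → a ∈ B → a ≤ top
      complement : ∀ a → a ∈ B →
                   ∃[ b ] (b ∈ B × (a ⊓ b ≈ ⊥) × (a ⊔ b ≈ top))

  -- An injective homomorphism of complete Boolean algebras from the powerset
  -- of X onto a complete Boolean sub-algebra with greatest element h U (the
  -- image of h, which the homomorphism laws make a sub-algebra).
  --
  -- `Pred X ℓ` up to _≐_ is a Boolean algebra only classically.  No separate
  -- excluded middle hypothesis is needed: for inhabited X it is a consequence
  -- of h-⋃ and h-⊔-∁ together with injectivity.

  record IsPowersetEmbedding {X : Set ℓ} (h : Pred X ℓ → Carrier)
                             : Set (lsuc ℓ) where
    field
      h-cong      : ∀ {p q} → p ≐ q → h p ≈ h q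
      h-injective : ∀ {p q} → h p ≈ h q → p ≐ q
      h-∅         : h ∅ ≈ ⊥
      h-⋃         : {I : Set ℓ} (p : I → Pred X ℓ) →
                    h (⋃ I p) ≈ ⨆ (λ i → h (p i))
      h-⋂         : {I : Set ℓ} → I → (p : I → Pred X ℓ) →
                    h (⋂ I p) ≈ ⨅ (λ i → h (p i))
      h-⊓-∁       : ∀ p → h p ⊓ h (∁ p) ≈ ⊥
      h-⊔-∁       : ∀ p → h p ⊔ h (∁ p) ≈ h U

-- `nothing` marks the variables outside the domain of a partial function.

State : (V S : Set ℓ) → Set ℓ
State V S = V → Maybe S

StateSet : (V S : Set ℓ) → Set (lsuc ℓ)
StateSet {ℓ} V S = Pred (State V S) ℓ

StateRel : (V S : Set ℓ) → Set (lsuc ℓ)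
StateRel {ℓ} V S = Pred (State V S × State V S) ℓ

module _ {V S : Set ℓ} where

  -- Left-to-right; the library's _;_ is the Greek question mark U+037E.

  infixr 9 _∘ᴿ_
  _∘ᴿ_ : StateRel V S → StateRel V S → StateRel V S
  r ∘ᴿ s = uncurry (curry r ; curry s)

  id-except : V → StateRel V S
  id-except x (σ , σ′) = ∀ y → y ≢ x → σ y ≡ σ′ y

  Eˢ : V → StateSet V S → StateSet V S
  Eˢ x p σ′ = ∃[ σ ] (σ ∈ p × (σ , σ′) ∈ id-except x)

  Eᴿ-first : V → StateRel V S → StateRel V S
  Eᴿ-first x r = id-except x ∘ᴿ r

  Eᴿ-last : V → StateRel V S → StateRel V S
  Eᴿ-last x r = r ∘ᴿ id-except x

  Eᴿ : V → StateRel V S → StateRel V S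
  Eᴿ x r = id-except x ∘ᴿ r ∘ᴿ id-except x

  Aᴿ : V → StateRel V S → StateRel V S
  Aᴿ x r = ∁ (Eᴿ x (∁ r))

record CommandAlgebra {ℓ} (V S : Set ℓ) : Set (lsuc ℓ) where
  field
    lattice : CompleteDistributiveLattice ℓ

  open CompleteDistributiveLattice lattice public

  infixr 8 _⨾_
  infixr 7 _⋒_
  infix  9 _^⋆ _^ω _^∞ _^_

  field
    _⨾_          : Op₂ Carrier
    nil          : Carrier
    ⨾-isMonoid   : IsMonoid _≈_ _⨾_ nil
    ⨾-mono       : _⨾_ Preserves₂ _≤_ ⟶ _≤_ ⟶ _≤_

  _^_ : Carrier → ℕ → Carrier
  c ^ i = fold nil (c ⨾_) i

  field
    _^⋆          : Op₁ Carrier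
    _^ω          : Op₁ Carrier
    ^⋆-lfp       : ∀ c → IsLeastFixedPoint lattice (λ y → nil ⊔ c ⨾ y) (c ^⋆)
    ^ω-gfp       : ∀ c → IsGreatestFixedPoint lattice (λ y → nil ⊔ c ⨾ y) (c ^ω)

  _^∞ : Op₁ Carrier
  c ^∞ = c ^ω ⨾ ⊥

  field
    ^⋆-⨆         : ∀ c → c ^⋆ ≈ ⨆ {I = Lift ℓ ℕ} (λ i → c ^ lower i)
    ^ω-decompose : ∀ c → c ^ω ≈ c ^⋆ ⊔ c ^∞

  field
    τ            : StateSet V S → Carrier
    π            : StateRel V S → Carrier
    ε            : StateRel V S → Carrier
    τ-embedding  : IsPowersetEmbedding lattice τ
    π-embedding  : IsPowersetEmbedding lattice π
    ε-embedding  : IsPowersetEmbedding lattice ε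
    τ-U          : τ U ≈ nil

  πᵁ : Carrier
  πᵁ = π U

  εᵁ : Carrier
  εᵁ = ε U

  α : Carrier
  α = πᵁ ⊔ εᵁ

  chaos : Carrier
  chaos = α ^ω

  -- That πᵁ and εᵁ are complements in Atomic is πᵁ⊓εᵁ together with α, which
  -- is πᵁ ⊔ εᵁ by definition, being the greatest element of Atomic.

  field
    Atomic            : Pred Carrier ℓ
    Atomic-subalgebra : IsCompleteBooleanSubalgebra lattice Atomic α
    π-atomic          : ∀ r → π r ∈ Atomic
    ε-atomic          : ∀ r → ε r ∈ Atomic
    πᵁ⊓εᵁ             : πᵁ ⊓ εᵁ ≈ ⊥

  field
    _⋒_            : Op₂ Carrier
    ⋒-isICMonoid   : IsIdempotentCommutativeMonoid _≈_ _⋒_ chaos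
    ⋒-mono         : _⋒_ Preserves₂ _≤_ ⟶ _≤_ ⟶ _≤_
    atomic-⋒       : ∀ a → a ∈ Atomic → a ≈ a ⋒ (α ⨾ chaos)

  rely : StateRel V S → Carrier
  rely r = (α ⊔ ε (∁ r) ⨾ ⊤) ^ω

  -- A standing property of the algebra.  Its usual derivation needs
  -- distributivity of _⨾_ over joins, which is not assumed here.

  field
    rely-expand    : ∀ r → rely r ≈ α ^ω ⨾ (nil ⊔ ε (∁ r) ⨾ ⊤)

module _ {V S : Set ℓ} (A : CommandAlgebra V S) where
  open CommandAlgebra A

  record IsLocalisation (F : V → Op₁ Carrier) : Set (lsuc ℓ) where
    field
      F-cong      : ∀ x → F x Preserves _≈_ ⟶ _≈_
      F-extensive : ∀ x c → c ≤ F x c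
      F-⊓         : ∀ x c d → F x (c ⊓ F x d) ≈ F x c ⊓ F x d
      F-comm      : ∀ x y c → F x (F y c) ≈ F y (F x c)
      F-⨆         : ∀ x {I : Set ℓ} (f : I → Carrier) →
                    F x (⨆ f) ≈ ⨆ (λ i → F x (f i))

record LocalisedAlgebra {ℓ} (V S : Set ℓ) : Set (lsuc ℓ) where
  field
    commandAlgebra : CommandAlgebra V S

  open CommandAlgebra commandAlgebra public

  field
    E E-first E-last       : V → Op₁ Carrier
    E-isLocalisation       : IsLocalisation commandAlgebra E
    E-first-isLocalisation : IsLocalisation commandAlgebra E-first
    E-last-isLocalisation  : IsLocalisation commandAlgebra E-last

    E-first≤E              : ∀ x c → E-first x c ≤ E x c
    E-last≤E               : ∀ x c → E-last x c ≤ E x c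
    E-E-first              : ∀ x y c → E x (E-first y c) ≈ E-first y (E x c)
    E-E-last               : ∀ x y c → E x (E-last y c) ≈ E-last y (E x c)
    E-first-E-last         : ∀ x y c →
                             E-first x (E-last y c) ≈ E-last y (E-first x c)

    E-τ                    : ∀ x p → E x (τ p) ≈ τ (Eˢ x p)
    E-first-τ              : ∀ x p → E-first x (τ p) ≈ τ (Eˢ x p)
    E-last-τ               : ∀ x p → E-last x (τ p) ≈ τ (Eˢ x p)
    E-π                    : ∀ x r → E x (π r) ≈ π (Eᴿ x r)
    E-first-π              : ∀ x r → E-first x (π r) ≈ π (Eᴿ-first x r)
    E-last-π               : ∀ x r → E-last x (π r) ≈ π (Eᴿ-last x r)
    E-ε                    : ∀ x r → E x (ε r) ≈ ε (Eᴿ x r)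
    E-first-ε              : ∀ x r → E-first x (ε r) ≈ ε (Eᴿ-first x r)
    E-last-ε               : ∀ x r → E-last x (ε r) ≈ ε (Eᴿ-last x r)

    E-⨾-first              : ∀ x c d → E x (c ⨾ E-first x d) ≈ E x c ⨾ E x d
    E-⨾-last               : ∀ x c d → E x (E-last x c ⨾ d) ≈ E x c ⨾ E x d
    E-first-⨾              : ∀ x c d → c ≈ c ⋒ (α ⨾ chaos) →
                             E-first x (c ⨾ d) ≈ E-first x c ⨾ d
    E-last-⨾               : ∀ x c d → c ≈ c ⋒ (α ⨾ chaos) →
                             E-last x (d ⨾ c) ≈ d ⨾ E-last x c

    E-⋒                    : ∀ x c d → E x (c ⋒ E x d) ≈ E x c ⋒ E x d
    E-first-⋒              : ∀ x c d →
                             E-first x (c ⋒ E-first x d) ≈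
                             E-first x c ⋒ E-first x d

{-# OPTIONS --safe #-}

-- Write rely r as α^ω ; (nil ⊔ ε(r̄) ; ⊤).  Since α = E-last α = E α, applying E
-- to the unfolding α^ω = nil ⊔ α ; α^ω shows that E (α^ω) solves the same
-- equation, so E (α^ω) ≤ α^ω because α^ω is the greatest solution; hence both
-- E and E-last fix α^ω, and E distributes over the sequential composition.
-- Likewise E-first fixes ⊤, so E acts on ε(r̄) ; ⊤ through ε(r̄) alone.

module Submission where

open import Defs
open import Algebra.Core using (Op₁)
open import Algebra.Structures using (IsMonoid)
open import Data.Bool.Base using (Bool; true; false; if_then_else_)
open import Data.Nat.Base using (ℕ)
open import Data.Product.Base using (_,_; proj₁; proj₂)
open import Data.Unit.Polymorphic.Base using (tt)
open import Function.Bundles using (_↣_)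
open import Level using (Level; Lift; lift; lower)
open import Relation.Binary.Lattice.Bundles using (DistributiveLattice)
import Relation.Binary.Lattice.Properties.JoinSemilattice as JoinSemilatticeProperties
import Relation.Binary.Lattice.Properties.MeetSemilattice as MeetSemilatticeProperties
import Relation.Binary.Reasoning.Setoid as SetoidReasoning
open import Relation.Binary.PropositionalEquality.Core as ≡ using ()
open import Relation.Unary using (Pred; ∁; _≐_)
open import Relation.Unary.Polymorphic using (U)

private
  variable
    ℓ : Level

module _ (L : CompleteDistributiveLattice ℓ) where
  open CompleteDistributiveLattice L

  distributiveLattice : DistributiveLattice ℓ ℓ ℓ
  distributiveLattice = record { isDistributiveLattice = isDistributiveLattice }

module _ (L : CompleteDistributiveLattice ℓ) where
  open CompleteDistributiveLattice L
  open DistributiveLattice (distributiveLattice L)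
    using (antisym; trans; refl; reflexive; module Eq; x≤x∨y; y≤x∨y; ∨-least;
           x∧y≤y; ∧-greatest; joinSemilattice; meetSemilattice; ∧-distribˡ-∨)
  open JoinSemilatticeProperties joinSemilattice using (∨-comm)
  open MeetSemilatticeProperties meetSemilattice using (∧-comm)

  -- Localisation is only assumed to preserve indexed joins; this transfers the law to `_⊔_`. `Lift`
  -- puts the two-element index in `Set ℓ`.
  ⨆-Bool : (f : Lift ℓ Bool → Carrier) → ⨆ f ≈ f (lift true) ⊔ f (lift false)
  ⨆-Bool f = antisym
    (⨆-least f _ λ { (lift true) → x≤x∨y _ _ ; (lift false) → y≤x∨y _ _ })
    (∨-least (⨆-upper f (lift true)) (⨆-upper f (lift false)))

  -- By distributivity, a ≤ a ⊓ (b ⊔ c) ≈ (a ⊓ b) ⊔ (a ⊓ c) ≤ b, and symmetrically. The joins need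
  -- only agree, not equal `⊤`: for an embedding `h` they are `h U`.
  complement-unique : ∀ {a b c} → a ⊓ c ≈ ⊥ → b ⊓ c ≈ ⊥ → a ⊔ c ≈ b ⊔ c → a ≈ b
  complement-unique {a} {b} {c} a⊓c≈⊥ b⊓c≈⊥ a⊔c≈b⊔c =
    antisym (below a⊓c≈⊥ a⊔c≈b⊔c) (below b⊓c≈⊥ (Eq.sym a⊔c≈b⊔c))
    where
    below : ∀ {a b} → a ⊓ c ≈ ⊥ → a ⊔ c ≈ b ⊔ c → a ≤ b
    below {a} {b} disjoint joins = trans
      (∧-greatest refl (trans (x≤x∨y a c) (reflexive joins)))
      (trans (reflexive (∧-distribˡ-∨ a b c))
        (∨-least (x∧y≤y a b) (trans (reflexive disjoint) (minimum b))))

  module _ {X : Set ℓ} {h : Pred X ℓ → Carrier}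
           (h-embedding : IsPowersetEmbedding L h) where
    open IsPowersetEmbedding h-embedding

    -- Constructively p and ∁ (∁ p) differ, but both images are complements of
    -- h (∁ p).
    h-∁∁ : ∀ p → h (∁ (∁ p)) ≈ h p
    h-∁∁ p = complement-unique
      (Eq.trans (∧-comm _ _) (h-⊓-∁ (∁ p)))
      (h-⊓-∁ p)
      (Eq.trans (∨-comm _ _)
        (Eq.trans (h-⊔-∁ (∁ p)) (Eq.sym (h-⊔-∁ p))))

module _ {V S : Set ℓ} (x : V) where

  Eˢ-U : Eˢ {S = S} x U ≐ U {ℓ = ℓ}
  Eˢ-U = (λ _ → tt) , λ {σ} _ → σ , tt , λ _ _ → ≡.refl

  Eᴿ-U : Eᴿ {S = S} x U ≐ U {ℓ = ℓ}
  Eᴿ-U = (λ _ → tt) ,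
         λ { {σ , σ′} _ → σ , (λ _ _ → ≡.refl) , σ′ , tt , λ _ _ → ≡.refl }

module _ {V S : Set ℓ} (A : CommandAlgebra V S) {F : V → Op₁ (CommandAlgebra.Carrier A)}
         (F-isLocalisation : IsLocalisation A F) where
  open CommandAlgebra A
  open IsLocalisation F-isLocalisation
  open DistributiveLattice (distributiveLattice lattice) using (setoid; antisym)
  open SetoidReasoning setoid

  F-⊔ : ∀ x c d → F x (c ⊔ d) ≈ F x c ⊔ F x d
  F-⊔ x c d = begin
    F x (c ⊔ d)          ≈⟨ F-cong x (⨆-Bool lattice f) ⟨
    F x (⨆ f)            ≈⟨ F-⨆ x f ⟩
    ⨆ (λ b → F x (f b))  ≈⟨ ⨆-Bool lattice (λ b → F x (f b)) ⟩
    F x c ⊔ F x d        ∎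
    where
    f : Lift _ Bool → Carrier
    f b = if lower b then c else d

  F-⊤ : ∀ x → F x ⊤ ≈ ⊤
  F-⊤ x = antisym (maximum _) (F-extensive x ⊤)

module _ {V S : Set ℓ} (M : LocalisedAlgebra V S) (x : V) where
  open LocalisedAlgebra M
  open DistributiveLattice (distributiveLattice lattice)
    using (setoid; module Eq; antisym; trans; reflexive; joinSemilattice)
  open JoinSemilatticeProperties joinSemilattice using (∨-cong)
  open IsMonoid ⨾-isMonoid using () renaming (∙-cong to ⨾-cong)
  open IsLocalisation E-isLocalisation using () renaming (F-cong to E-cong)
  open SetoidReasoning setoid

  -- `E-last x c` is squeezed between `c` and `E x c`.
  E-fixed⇒E-last-fixed : ∀ {c} → E x c ≈ c → E-last x c ≈ c
  E-fixed⇒E-last-fixed {c} Ec≈c = antisym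
    (trans (E-last≤E x c) (reflexive Ec≈c))
    (IsLocalisation.F-extensive E-last-isLocalisation x c)

  -- A fixed left factor can be rewritten as its own `E-last`, the shape that `E-⨾-last` requires.
  E-⨾-fixed : ∀ {c} d → E x c ≈ c → E x (c ⨾ d) ≈ c ⨾ E x d
  E-⨾-fixed {c} d Ec≈c = begin
    E x (c ⨾ d)            ≈⟨ E-cong x (⨾-cong (E-fixed⇒E-last-fixed Ec≈c) Eq.refl) ⟨
    E x (E-last x c ⨾ d)   ≈⟨ E-⨾-last x c d ⟩
    E x c ⨾ E x d          ≈⟨ ⨾-cong Ec≈c Eq.refl ⟩
    c ⨾ E x d              ∎

  E-⨾-⊤ : ∀ c → E x (c ⨾ ⊤) ≈ E x c ⨾ ⊤
  E-⨾-⊤ c = begin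
    E x (c ⨾ ⊤)             ≈⟨ E-cong x (⨾-cong Eq.refl (F-⊤ commandAlgebra E-first-isLocalisation x)) ⟨
    E x (c ⨾ E-first x ⊤)   ≈⟨ E-⨾-first x c ⊤ ⟩
    E x c ⨾ E x ⊤           ≈⟨ ⨾-cong Eq.refl (F-⊤ commandAlgebra E-isLocalisation x) ⟩
    E x c ⨾ ⊤               ∎

  E-⊔ : ∀ c d → E x (c ⊔ d) ≈ E x c ⊔ E x d
  E-⊔ = F-⊔ commandAlgebra E-isLocalisation x

  E-nil : E x nil ≈ nil
  E-nil = begin
    -- Viewing `nil` as the test on all states makes the localisation law for tests applicable.
    E x nil       ≈⟨ E-cong x τ-U ⟨
    E x (τ U)     ≈⟨ E-τ x U ⟩
    τ (Eˢ x U)    ≈⟨ IsPowersetEmbedding.h-cong τ-embedding (Eˢ-U x) ⟩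
    τ U           ≈⟨ τ-U ⟩
    nil           ∎

  E-α : E x α ≈ α
  E-α = begin
    E x (πᵁ ⊔ εᵁ)               ≈⟨ E-⊔ πᵁ εᵁ ⟩
    E x πᵁ ⊔ E x εᵁ             ≈⟨ ∨-cong (E-π x U) (E-ε x U) ⟩
    π (Eᴿ x U) ⊔ ε (Eᴿ x U)     ≈⟨ ∨-cong
                                     (IsPowersetEmbedding.h-cong π-embedding (Eᴿ-U x))
                                     (IsPowersetEmbedding.h-cong ε-embedding (Eᴿ-U x)) ⟩
    πᵁ ⊔ εᵁ                     ∎

  E-fixed⇒E-^ω-fixed : ∀ {c} → E x c ≈ c → E x (c ^ω) ≈ c ^ω
  E-fixed⇒E-^ω-fixed {c} Ec≈c = antisym
    -- Maximality of `c ^ω` is only assumed against exact fixed points, so `unfold` has to be an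
    -- equation rather than an inequality.
    (proj₂ (^ω-gfp c) (E x (c ^ω)) unfold)
    (IsLocalisation.F-extensive E-isLocalisation x (c ^ω))
    where
    unfold : nil ⊔ c ⨾ E x (c ^ω) ≈ E x (c ^ω)
    unfold = begin
      nil ⊔ c ⨾ E x (c ^ω)         ≈⟨ ∨-cong E-nil (E-⨾-fixed (c ^ω) Ec≈c) ⟨
      E x nil ⊔ E x (c ⨾ c ^ω)     ≈⟨ E-⊔ nil (c ⨾ c ^ω) ⟨
      E x (nil ⊔ c ⨾ c ^ω)         ≈⟨ E-cong x (proj₁ (^ω-gfp c)) ⟩
      E x (c ^ω)                   ∎

  E-rely : ∀ r → E x (rely r) ≈ rely (Aᴿ x r)
  E-rely r = begin
    -- The body of the iteration defining `rely r` need not be fixed by `E x`; after expansion only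
    -- `α` is iterated, and it is fixed.
    E x (rely r)                                ≈⟨ E-cong x (rely-expand r) ⟩
    E x (α ^ω ⨾ (nil ⊔ ε (∁ r) ⨾ ⊤))            ≈⟨ E-⨾-fixed _ (E-fixed⇒E-^ω-fixed E-α) ⟩
    α ^ω ⨾ E x (nil ⊔ ε (∁ r) ⨾ ⊤)              ≈⟨ ⨾-cong Eq.refl (E-⊔ _ _) ⟩
    α ^ω ⨾ (E x nil ⊔ E x (ε (∁ r) ⨾ ⊤))        ≈⟨ ⨾-cong Eq.refl (∨-cong E-nil (E-⨾-⊤ _)) ⟩
    α ^ω ⨾ (nil ⊔ E x (ε (∁ r)) ⨾ ⊤)            ≈⟨ ⨾-cong Eq.refl (∨-cong Eq.refl (⨾-cong
                                                     E-ε-∁ Eq.refl)) ⟩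
    α ^ω ⨾ (nil ⊔ ε (∁ (Aᴿ x r)) ⨾ ⊤)           ≈⟨ rely-expand (Aᴿ x r) ⟨
    rely (Aᴿ x r)                               ∎
    where
    -- `∁ (Aᴿ x r)` unfolds to the double complement of `Eᴿ x (∁ r)`, which is removed under `ε`
    -- rather than on the relations themselves.
    E-ε-∁ : E x (ε (∁ r)) ≈ ε (∁ (Aᴿ x r))
    E-ε-∁ = Eq.trans (E-ε x (∁ r))
      (Eq.sym (h-∁∁ lattice ε-embedding (Eᴿ x (∁ r))))

mainTheorem3 : ∀ {ℓ : Level} (V S : Set ℓ) → V ↣ ℕ →
    (M : LocalisedAlgebra V S) →
    let open LocalisedAlgebra M in
    (r : StateRel V S) (x : V) → E x (rely r) ≈ rely (Aᴿ x r)
mainTheorem3 V S _ M r x = E-rely M x r
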